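{- Let $n\ge 2$ and let $\mu$ be a locally valid MV assignment of $M_{2,n}$ having exactly two flippable faces (i.e., a vertex of degree $2$ in ${\rm OFG}(M_{2,n})$). Let $-\mu$ be the opposite assignment, which negates every crease. Then the distance between $\mu$ and $-\mu$ in ${\rm OFG}(M_{2,n})$ (the length of a shortest path) is $\lceil n^2/2\rceil$.
   Context: The $2\times n$ Miura-ori $M_{2,n}$ ($n\ge1$) has faces $\alpha_{i,j}$ ($i\in\{1,2\}$, $j\in\{1,\dots,n\}$), interior vertices $x_1,\dots,x_{n-1}$, and creases $e_0$ and $e_{3k-1},e_{3k},e_{3k+1}$ ($k=1,\dots,n-1$). At $x_k$ the creases are left $e_{3k-3}$, top $e_{3k-1}$, right $e_{3k}$, bottom $e_{3k+1}$ (angles adjacent to the left crease obtuse). Face $\alpha_{1,j}$ is bordered by those of $e_{3j-4}$ (iff $j\ge2$), $e_{3j-3}$, $e_{3j-1}$ (iff $j\le n-1$); $\alpha_{2,j}$ by those of $e_{3j-2}$ (iff $j\ge2$), $e_{3j-3}$, $e_{3j+1}$ (iff $j\le n-1$). An MV assignment $\mu$ maps creases to $\{1,-1\}$; it is locally valid if for each $k$ exactly one of $\mu(e_{3k-1}),\mu(e_{3k}),\mu(e_{3k+1})$ differs from $\mu(e_{3k-3})$. The face flip $\mu_\alpha$ negates $\mu$ on the creases bordering $\alpha$; $\alpha$ is flippable under $\mu$ if $\mu,\mu_\alpha$ are both locally valid. ${\rm OFG}(M_{2,n})$ has the locally valid assignments as vertices, with $\mu\sim\mu_\alpha$ for each flippable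 $\alpha$. Two assignments are called opposite if they have the same flippable faces and opposite MV parity on every crease; for a locally valid $\mu$, $-\mu$ is locally valid and opposite to $\mu$. -}

module Defs where

open import Data.Bool.Base using (if_then_else_)
open import Data.Empty using (⊥)
open import Data.Fin.Base using (Fin; suc; inject₁)
open import Data.Fin.Properties using (_≟_)
open import Data.Nat.Base using (ℕ; suc; pred; _≤_)
open import Data.Product using (Σ; ∃; ∃!; ∃₂; _×_; _,_; proj₁)
open import Data.Sign.Base using (Sign; opposite)
open import Data.Sign.Properties using (opposite-injective)
open import Data.Sum.Base using (_⊎_)
open import Function.Base using (_∘_)
open import Relation.Binary.PropositionalEquality using (_≡_; _≢_; _≗_; cong)
open import Relation.Nullary using (Dec; no; does; _⊎-dec_)

-- Everything is 0-based: columns are Fin n, and the interior vertices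
-- x₁ , … , xₙ₋₁ are Fin (pred n).
Vertex : ℕ → Set
Vertex n = Fin (pred n)

-- The interior vertex x_k lies between the columns k and k+1 (1-based).
leftColumn : ∀ {n} → Vertex n → Fin n
leftColumn {suc n} k = inject₁ k

rightColumn : ∀ {n} → Vertex n → Fin n
rightColumn {suc n} k = suc k

-- In the 1-based labelling of the creases:
--   horizontal j  is  e_{3j-3}  (1 ≤ j ≤ n),   shared by α_{1,j} and α_{2,j};
--   top k         is  e_{3k-1}  (1 ≤ k ≤ n-1), shared by α_{1,k} and α_{1,k+1};
--   bottom k      is  e_{3k+1}  (1 ≤ k ≤ n-1), shared by α_{2,k} and α_{2,k+1}.
data Crease (n : ℕ) : Set where
  horizontal : Fin n → Crease n
  top        : Vertex n → Crease n
  bottom     : Vertex n → Crease n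

-- α₁ j and α₂ j are the faces α_{1,j} and α_{2,j}.
data Face (n : ℕ) : Set where
  α₁ α₂ : Fin n → Face n

Borders : ∀ {n} → Face n → Crease n → Set
Borders (α₁ j) (horizontal i) = i ≡ j
Borders (α₁ j) (top k)        = leftColumn k ≡ j ⊎ rightColumn k ≡ j
Borders (α₁ j) (bottom k)     = ⊥
Borders (α₂ j) (horizontal i) = i ≡ j
Borders (α₂ j) (top k)        = ⊥
Borders (α₂ j) (bottom k)     = leftColumn k ≡ j ⊎ rightColumn k ≡ j

borders? : ∀ {n} (α : Face n) (e : Crease n) → Dec (Borders α e)
borders? (α₁ j) (horizontal i) = i ≟ j
borders? (α₁ j) (top k)        = (leftColumn k ≟ j) ⊎-dec (rightColumn k ≟ j)
borders? (α₁ j) (bottom k)     = no λ ()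
borders? (α₂ j) (horizontal i) = i ≟ j
borders? (α₂ j) (top k)        = no λ ()
borders? (α₂ j) (bottom k)     = (leftColumn k ≟ j) ⊎-dec (rightColumn k ≟ j)

Assignment : ℕ → Set
Assignment n = Crease n → Sign

left : ∀ {n} → Vertex n → Crease n
left k = horizontal (leftColumn k)

data Direction : Set where
  above ahead below : Direction

nonLeft : ∀ {n} → Vertex n → Direction → Crease n
nonLeft k above = top k
nonLeft k ahead = horizontal (rightColumn k)
nonLeft k below = bottom k

LocallyValid : ∀ {n} → Assignment n → Set
LocallyValid {n} μ =
  (k : Vertex n) → ∃! _≡_ λ d → μ (nonLeft k d) ≢ μ (left k)

flip : ∀ {n} → Face n → Assignment n → Assignment n
flip α μ e = if does (borders? α e) then opposite (μ e) else μ e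

Flippable : ∀ {n} → Assignment n → Face n → Set
Flippable μ α = LocallyValid μ × LocallyValid (flip α μ)

ExactlyTwoFlippable : ∀ {n} → Assignment n → Set
ExactlyTwoFlippable μ = ∃₂ λ α β →
  α ≢ β × Flippable μ α × Flippable μ β ×
  (∀ γ → Flippable μ γ → γ ≡ α ⊎ γ ≡ β)

-- The vertices of the origami flip graph. Two of them count as the same vertex
-- when their assignments agree pointwise (≗); the validity proof is irrelevant.
OFG : ℕ → Set
OFG n = Σ (Assignment n) LocallyValid

Adjacent : ∀ {n} → OFG n → OFG n → Set
Adjacent (μ , _) (ν , _) = ∃ λ α → Flippable μ α × ν ≗ flip α μ

data Walk {n : ℕ} : OFG n → OFG n → ℕ → Set where
  done : ∀ {u v} → proj₁ u ≗ proj₁ v → Walk u v 0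
  step : ∀ {u v w l} → Adjacent u v → Walk v w l → Walk u w (suc l)

IsDistance : ∀ {n} → OFG n → OFG n → ℕ → Set
IsDistance u v d = Walk u v d × (∀ l → Walk u v l → d ≤ l)

negate : ∀ {n} → Assignment n → Assignment n
negate μ = opposite ∘ μ

negate-valid : ∀ {n} (μ : Assignment n) → LocallyValid μ → LocallyValid (negate μ)
negate-valid μ valid k with valid k
... | d , differs , unique =
  d , differs ∘ opposite-injective , λ differs′ → unique (differs′ ∘ cong opposite)

opp : ∀ {n} → OFG n → OFG n
opp (μ , valid) = negate μ , negate-valid μ valid

{-# OPTIONS --safe #-}
module Submission where

-- A locally valid assignment is the gradient of a height function on the faces,
-- integer-valued and changing by ±1 across every crease; the flippable faces are
-- its local extrema, and a flip moves the height of one face by ±2. The distance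
-- between two assignments is therefore half the ℓ¹-distance of their heights,
-- minimised over the additive constant. With only two flippable faces the heights
-- are forced to be ± the staircase j, j + 1 in column j, and negating the
-- assignment reflects the heights at some level x, at the cost Σ |x − H|. For a
-- level p inside the staircase this is p² + (n − p)², least at the median.

open import Defs
open import Data.Bool.Base using (if_then_else_)
open import Data.Fin.Base using (Fin; zero; suc; inject₁; fromℕ; toℕ)
open import Data.Fin.Induction using (<-weakInduction)
open import Data.Fin.Properties as Fin using ()
open import Data.Integer.Base using (ℤ; +_; -[1+_]; _+_; _*_; -_; ∣_∣; 0ℤ; _<_; +<+; -<+)
import Data.Integer.Base as ℤ
open import Data.Integer.Properties as ℤ using ()
open import Data.Integer.Tactic.RingSolver using (solve-∀)
open import Data.List.Base using (List; map; _++_; allFin; filter)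
open import Data.List.Extrema ℤ.≤-totalOrder using (argmin; argmin-all; f[argmin]≤f[xs])
open import Data.List.Membership.Propositional using (_∈_)
open import Data.List.Membership.Propositional.Properties using (∈-++⁺ˡ; ∈-++⁺ʳ; ∈-map⁺; ∈-allFin; ∈-filter⁺)
open import Data.List.Relation.Unary.All as All using ()
open import Data.List.Relation.Unary.All.Properties using (all-filter)
open import Data.Nat using (ℕ; _≤_; _^_; ⌈_/2⌉)
open import Data.Nat.Base as ℕ using (zero; suc; s≤s; z≤n; ⌊_/2⌋)
open import Data.Nat.Properties as ℕ using ()
import Data.Nat.Tactic.RingSolver as ℕ-Solver
open import Data.Product using (∃; ∃!; ∃₂; _×_; _,_; proj₁; proj₂)
open import Data.Sign.Base using (Sign; opposite)
open import Data.Sign.Properties as Sign using (opposite-injective; opposite-involutive)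
open import Data.Sum.Base using (_⊎_; inj₁; inj₂; [_,_]; [_,_]′)
open import Function.Base using (_∘_; case_of_)
open import Relation.Binary.Definitions using (DecidableEquality)
open import Relation.Binary.PropositionalEquality using (_≡_; _≢_; _≗_; refl; sym; trans; cong; cong₂; subst; subst₂; module ≡-Reasoning)
open import Relation.Nullary using (¬_; yes; no; does; contradiction)
open import Relation.Nullary.Decidable using (dec-true; dec-false; map′)
open import Algebra.Properties.AbelianGroup ℤ.+-0-abelianGroup using () renaming (∙-cancelˡ to +-cancelˡ)
open import Algebra.Properties.CommutativeMonoid.Sum ℕ.+-0-commutativeMonoid using (sum; sum-cong-≗; sum-replicate-zero)

-- Signs as units of ℤ

⟦_⟧ : Sign → ℤ
⟦ Sign.+ ⟧ = + 1
⟦ Sign.- ⟧ = -[1+ 0 ]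

⟦⟧-injective : ∀ {s t} → ⟦ s ⟧ ≡ ⟦ t ⟧ → s ≡ t
⟦⟧-injective {Sign.+} {Sign.+} _ = refl
⟦⟧-injective {Sign.-} {Sign.-} _ = refl

⟦⟧-opposite : ∀ s → ⟦ opposite s ⟧ ≡ - ⟦ s ⟧
⟦⟧-opposite Sign.+ = refl
⟦⟧-opposite Sign.- = refl

≢⇒≡opposite : ∀ {s t} → s ≢ t → s ≡ opposite t
≢⇒≡opposite {Sign.+} {Sign.+} s≢t = contradiction refl s≢t
≢⇒≡opposite {Sign.+} {Sign.-} _   = refl
≢⇒≡opposite {Sign.-} {Sign.+} _   = refl
≢⇒≡opposite {Sign.-} {Sign.-} s≢t = contradiction refl s≢t

-- Says that exactly one of t, r and b differs from l.
Balanced : Sign → Sign → Sign → Sign → Set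
Balanced l t r b = ⟦ l ⟧ ≡ ⟦ t ⟧ + ⟦ r ⟧ + ⟦ b ⟧

balanced-swap : ∀ l t r b → Balanced l t r b → Balanced l b r t
balanced-swap l t r b eq = trans eq (swap ⟦ t ⟧ ⟦ r ⟧ ⟦ b ⟧)
  where
  swap : ∀ x y z → x + y + z ≡ z + y + x
  swap = solve-∀

-- Subtracting the two equations leaves 2l = 2t. This is the situation at the vertex ending a
-- flipped face on its right, where the left crease and one side crease are negated.
balanced-oppositeˡ : ∀ l t r b → Balanced l t r b →
  Balanced (opposite l) (opposite t) r b → t ≡ l
balanced-oppositeˡ Sign.+ Sign.+ _ _ _ _ = refl
balanced-oppositeˡ Sign.- Sign.- _ _ _ _ = refl
balanced-oppositeˡ Sign.+ Sign.- Sign.+ Sign.+ _ ()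
balanced-oppositeˡ Sign.+ Sign.- Sign.+ Sign.- ()
balanced-oppositeˡ Sign.+ Sign.- Sign.- Sign.+ ()
balanced-oppositeˡ Sign.+ Sign.- Sign.- Sign.- ()
balanced-oppositeˡ Sign.- Sign.+ Sign.+ Sign.+ ()
balanced-oppositeˡ Sign.- Sign.+ Sign.+ Sign.- ()
balanced-oppositeˡ Sign.- Sign.+ Sign.- Sign.+ ()
balanced-oppositeˡ Sign.- Sign.+ Sign.- Sign.- _ ()

-- Here the two equations differ by 2(t + r), which must vanish. This is the situation at the vertex
-- where a flipped face begins on its left.
balanced-oppositeʳ : ∀ l t r b → Balanced l t r b →
  Balanced l (opposite t) (opposite r) b → t ≡ opposite r
balanced-oppositeʳ _ Sign.+ Sign.- _ _ _ = refl
balanced-oppositeʳ _ Sign.- Sign.+ _ _ _ = refl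
balanced-oppositeʳ Sign.+ Sign.+ Sign.+ Sign.+ ()
balanced-oppositeʳ Sign.+ Sign.+ Sign.+ Sign.- _ ()
balanced-oppositeʳ Sign.- Sign.+ Sign.+ Sign.+ ()
balanced-oppositeʳ Sign.- Sign.+ Sign.+ Sign.- ()
balanced-oppositeʳ Sign.+ Sign.- Sign.- Sign.+ ()
balanced-oppositeʳ Sign.+ Sign.- Sign.- Sign.- ()
balanced-oppositeʳ Sign.- Sign.- Sign.- Sign.+ _ ()
balanced-oppositeʳ Sign.- Sign.- Sign.- Sign.- ()

-- Only one of the three signs may differ from `l`, so `t` and `b` cannot both do so. This produces
-- a flippable face in the first column.
balanced-left : ∀ l t r b → Balanced l t r b → t ≡ l ⊎ b ≡ l
balanced-left Sign.+ Sign.+ _ _ _ = inj₁ refl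
balanced-left Sign.- Sign.- _ _ _ = inj₁ refl
balanced-left Sign.+ Sign.- _ Sign.+ _ = inj₂ refl
balanced-left Sign.- Sign.+ _ Sign.- _ = inj₂ refl
balanced-left Sign.+ Sign.- Sign.+ Sign.- ()
balanced-left Sign.+ Sign.- Sign.- Sign.- ()
balanced-left Sign.- Sign.+ Sign.+ Sign.+ ()
balanced-left Sign.- Sign.+ Sign.- Sign.+ ()

-- If `t` and `b` both agreed with `r`, the sum would be 3 or -3, which is no unit. This produces a
-- flippable face in the last column.
balanced-right : ∀ l t r b → Balanced l t r b → t ≡ opposite r ⊎ b ≡ opposite r
balanced-right _ Sign.+ Sign.- _ _ = inj₁ refl
balanced-right _ Sign.- Sign.+ _ _ = inj₁ refl
balanced-right _ Sign.+ Sign.+ Sign.- _ = inj₂ refl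
balanced-right _ Sign.- Sign.- Sign.+ _ = inj₂ refl
balanced-right Sign.+ Sign.+ Sign.+ Sign.+ ()
balanced-right Sign.- Sign.+ Sign.+ Sign.+ ()
balanced-right Sign.+ Sign.- Sign.- Sign.- ()
balanced-right Sign.- Sign.- Sign.- Sign.- ()

balanced-opposite-side : ∀ s t r → Balanced s t r (opposite s) → t ≡ s × r ≡ s
balanced-opposite-side Sign.+ Sign.+ Sign.+ _ = refl , refl
balanced-opposite-side Sign.- Sign.- Sign.- _ = refl , refl
balanced-opposite-side Sign.+ Sign.+ Sign.- ()
balanced-opposite-side Sign.+ Sign.- Sign.+ ()
balanced-opposite-side Sign.+ Sign.- Sign.- ()
balanced-opposite-side Sign.- Sign.+ Sign.+ ()
balanced-opposite-side Sign.- Sign.+ Sign.- ()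
balanced-opposite-side Sign.- Sign.- Sign.+ ()

-- Creases as oriented edges

-- Bottom creases point left and all others right or down: with this orientation
-- local validity at a vertex says that the signed steps around it sum to zero.
tail head : ∀ {n} → Crease n → Face n
tail (horizontal j) = α₁ j
tail (top k)        = α₁ (leftColumn k)
tail (bottom k)     = α₂ (rightColumn k)
head (horizontal j) = α₂ j
head (top k)        = α₁ (rightColumn k)
head (bottom k)     = α₂ (leftColumn k)

column : ∀ {n} → Face n → Fin n
column (α₁ j) = j
column (α₂ j) = j

α₁-injective : ∀ {n} {i j : Fin n} → α₁ i ≡ α₁ j → i ≡ j
α₁-injective = cong column

α₂-injective : ∀ {n} {i j : Fin n} → α₂ i ≡ α₂ j → i ≡ j
α₂-injective = cong column

infix 4 _≟ᶠ_
_≟ᶠ_ : ∀ {n} → DecidableEquality (Face n)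
α₁ i ≟ᶠ α₁ j = map′ (cong α₁) α₁-injective (i Fin.≟ j)
α₁ i ≟ᶠ α₂ j = no λ ()
α₂ i ≟ᶠ α₁ j = no λ ()
α₂ i ≟ᶠ α₂ j = map′ (cong α₂) α₂-injective (i Fin.≟ j)

data Row : Set where
  row₁ row₂ : Row

other : Row → Row
other row₁ = row₂
other row₂ = row₁

face : ∀ {n} → Row → Fin n → Face n
face row₁ = α₁
face row₂ = α₂

side : ∀ {n} → Row → Vertex n → Crease n
side row₁ = top
side row₂ = bottom

column-face : ∀ {n} r (j : Fin n) → column (face r j) ≡ j
column-face row₁ j = refl
column-face row₂ j = refl

other-face≢face : ∀ {n} r {i j : Fin n} → face (other r) i ≢ face r j
other-face≢face row₁ ()
other-face≢face row₂ ()

suc≢inject₁ : ∀ {n} (k : Fin n) → suc k ≢ inject₁ k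
suc≢inject₁ (suc k) eq = suc≢inject₁ k (Fin.suc-injective eq)

tail≢head : ∀ {n} (e : Crease n) → tail e ≢ head e
tail≢head             (horizontal j) ()
tail≢head {n = suc n} (top k)    eq = suc≢inject₁ k (sym (α₁-injective eq))
tail≢head {n = suc n} (bottom k) eq = suc≢inject₁ k (α₂-injective eq)

tail-borders : ∀ {n} (e : Crease n) → Borders (tail e) e
tail-borders (horizontal j) = refl
tail-borders (top k)        = inj₁ refl
tail-borders (bottom k)     = inj₂ refl

head-borders : ∀ {n} (e : Crease n) → Borders (head e) e
head-borders (horizontal j) = refl
head-borders (top k)        = inj₂ refl
head-borders (bottom k)     = inj₁ refl

borders⇒tail⊎head : ∀ {n} (α : Face n) e → Borders α e → tail e ≡ α ⊎ head e ≡ α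
borders⇒tail⊎head (α₁ j) (horizontal i) eq        = inj₁ (cong α₁ eq)
borders⇒tail⊎head (α₁ j) (top k)        (inj₁ eq) = inj₁ (cong α₁ eq)
borders⇒tail⊎head (α₁ j) (top k)        (inj₂ eq) = inj₂ (cong α₁ eq)
borders⇒tail⊎head (α₂ j) (horizontal i) eq        = inj₂ (cong α₂ eq)
borders⇒tail⊎head (α₂ j) (bottom k)     (inj₁ eq) = inj₂ (cong α₂ eq)
borders⇒tail⊎head (α₂ j) (bottom k)     (inj₂ eq) = inj₁ (cong α₂ eq)

flip-borders : ∀ {n} (α : Face n) μ e → Borders α e → flip α μ e ≡ opposite (μ e)
flip-borders α μ e b rewrite dec-true (borders? α e) b = refl

flip-fixes : ∀ {n} (α : Face n) μ e → tail e ≢ α → head e ≢ α → flip α μ e ≡ μ e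
flip-fixes α μ e t≢α h≢α
  rewrite dec-false (borders? α e) ([ t≢α , h≢α ] ∘ borders⇒tail⊎head α e) = refl

-- Local validity and height functions

BalancedAt : ∀ {n} → Assignment n → Vertex n → Set
BalancedAt μ k = Balanced (μ (left k)) (μ (top k)) (μ (horizontal (rightColumn k))) (μ (bottom k))

module _ (f : Direction → Sign) (l : Sign) where

  -- If m of the three signs differ from `l`, their sum is (3 - 2m) times `l`, which equals `l`
  -- exactly for m = 1. The converse below rests on the same count.
  unique⇒balanced : (∃! _≡_ λ d → f d ≢ l) → Balanced l (f above) (f ahead) (f below)
  unique⇒balanced (d , differs , unique) = balance d (≢⇒≡opposite differs) agrees
    where
    agrees : ∀ {d′} → d ≢ d′ → f d′ ≡ l
    agrees {d′} d≢d′ with f d′ Sign.≟ l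
    ... | yes eq = eq
    ... | no neq = contradiction (unique neq) d≢d′

    arithmetic : ∀ s → Balanced s (opposite s) s s × Balanced s s (opposite s) s × Balanced s s s (opposite s)
    arithmetic Sign.+ = refl , refl , refl
    arithmetic Sign.- = refl , refl , refl

    balance : ∀ d → f d ≡ opposite l → (∀ {d′} → d ≢ d′ → f d′ ≡ l) →
      Balanced l (f above) (f ahead) (f below)
    balance above eq eqs rewrite eq | eqs {ahead} (λ ()) | eqs {below} (λ ()) = proj₁ (arithmetic l)
    balance ahead eq eqs rewrite eq | eqs {above} (λ ()) | eqs {below} (λ ()) = proj₁ (proj₂ (arithmetic l))
    balance below eq eqs rewrite eq | eqs {above} (λ ()) | eqs {ahead} (λ ()) = proj₂ (proj₂ (arithmetic l))

  balanced⇒unique : Balanced l (f above) (f ahead) (f below) → ∃! _≡_ λ d → f d ≢ l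
  balanced⇒unique eq with f above Sign.≟ l | f ahead Sign.≟ l | f below Sign.≟ l
  ... | no p  | yes q | yes r = above , p , λ { {above} _ → refl ; {ahead} z → contradiction q z ; {below} z → contradiction r z }
  ... | yes p | no q  | yes r = ahead , q , λ { {above} z → contradiction p z ; {ahead} _ → refl ; {below} z → contradiction r z }
  ... | yes p | yes q | no r  = below , r , λ { {above} z → contradiction p z ; {ahead} z → contradiction q z ; {below} _ → refl }
  ... | yes p | yes q | yes r rewrite p | q | r = contradiction eq (impossible l)
    where
    impossible : ∀ s → ⟦ s ⟧ ≢ ⟦ s ⟧ + ⟦ s ⟧ + ⟦ s ⟧
    impossible Sign.+ ()
    impossible Sign.- ()
  ... | no p  | no q  | _     rewrite ≢⇒≡opposite p | ≢⇒≡opposite q = contradiction eq (impossible l (f below))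
    where
    impossible : ∀ s t → ⟦ s ⟧ ≢ ⟦ opposite s ⟧ + ⟦ opposite s ⟧ + ⟦ t ⟧
    impossible Sign.+ Sign.+ ()
    impossible Sign.+ Sign.- ()
    impossible Sign.- Sign.+ ()
    impossible Sign.- Sign.- ()
  ... | no p  | yes _ | no r  rewrite ≢⇒≡opposite p | ≢⇒≡opposite r = contradiction eq (impossible l (f ahead))
    where
    impossible : ∀ s t → ⟦ s ⟧ ≢ ⟦ opposite s ⟧ + ⟦ t ⟧ + ⟦ opposite s ⟧
    impossible Sign.+ Sign.+ ()
    impossible Sign.+ Sign.- ()
    impossible Sign.- Sign.+ ()
    impossible Sign.- Sign.- ()
  ... | yes _ | no q  | no r  rewrite ≢⇒≡opposite q | ≢⇒≡opposite r = contradiction eq (impossible l (f above))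
    where
    impossible : ∀ s t → ⟦ s ⟧ ≢ ⟦ t ⟧ + ⟦ opposite s ⟧ + ⟦ opposite s ⟧
    impossible Sign.+ Sign.+ ()
    impossible Sign.+ Sign.- ()
    impossible Sign.- Sign.+ ()
    impossible Sign.- Sign.- ()

valid⇒balanced : ∀ {n} (μ : Assignment n) → LocallyValid μ → ∀ k → BalancedAt μ k
valid⇒balanced μ valid k = unique⇒balanced (μ ∘ nonLeft k) (μ (left k)) (valid k)

balanced⇒valid : ∀ {n} (μ : Assignment n) → (∀ k → BalancedAt μ k) → LocallyValid μ
balanced⇒valid μ balanced k = balanced⇒unique (μ ∘ nonLeft k) (μ (left k)) (balanced k)

balanced-side : ∀ {n} (μ : Assignment n) → LocallyValid μ → ∀ r k →
  Balanced (μ (left k)) (μ (side r k)) (μ (horizontal (rightColumn k))) (μ (side (other r) k))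
balanced-side μ valid row₁ k = valid⇒balanced μ valid k
balanced-side μ valid row₂ k = balanced-swap (μ (left k)) (μ (top k)) _ (μ (bottom k)) (valid⇒balanced μ valid k)

Height : ℕ → Set
Height n = Face n → ℤ

-- `H` is a potential whose gradient along the oriented creases is `μ`. It is determined by `μ` up
-- to an additive constant, since the faces are connected through the creases.
record Realizes {n} (μ : Assignment n) (H : Height n) : Set where
  constructor realizes
  field
    ascent : ∀ e → H (head e) ≡ H (tail e) + ⟦ μ e ⟧
open Realizes

Realizes-cong : ∀ {n} {μ ν : Assignment n} {H G} → μ ≗ ν → H ≗ G → Realizes μ H → Realizes ν G
Realizes-cong {ν = ν} {G = G} μ≗ν H≗G real .ascent e =
  trans (sym (H≗G (head e))) (trans (ascent real e) (cong₂ (λ x s → x + ⟦ s ⟧) (H≗G (tail e)) (μ≗ν e)))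

Realizes-negate : ∀ {n} {μ : Assignment n} {H} → Realizes μ H → Realizes (negate μ) (-_ ∘ H)
Realizes-negate {μ = μ} {H} real .ascent e = begin
  - H (head e)                      ≡⟨ cong -_ (ascent real e) ⟩
  - (H (tail e) + ⟦ μ e ⟧)          ≡⟨ ℤ.neg-distrib-+ (H (tail e)) ⟦ μ e ⟧ ⟩
  - H (tail e) + - ⟦ μ e ⟧          ≡⟨ cong (λ x → - H (tail e) + x) (⟦⟧-opposite (μ e)) ⟨
  - H (tail e) + ⟦ opposite (μ e) ⟧ ∎
  where open ≡-Reasoning

-- Around an interior vertex there are two ways from the upper left face to the lower left one:
-- across the left crease, or across top, right and bottom. Both give the same height difference,
-- and equating them is the balance condition.
realizes⇒valid : ∀ {n} {μ : Assignment n} {H} → Realizes μ H → LocallyValid μ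
realizes⇒valid {suc n} {μ} {H} real = balanced⇒valid μ λ k →
  +-cancelˡ (H (α₁ (inject₁ k))) _ _ (begin
    H (α₁ (inject₁ k)) + ⟦ l k ⟧                       ≡⟨ ascent real (left k) ⟨
    H (α₂ (inject₁ k))                                 ≡⟨ ascent real (bottom k) ⟩
    H (α₂ (suc k)) + ⟦ b k ⟧                           ≡⟨ cong (_+ ⟦ b k ⟧) (ascent real (horizontal (suc k))) ⟩
    H (α₁ (suc k)) + ⟦ r k ⟧ + ⟦ b k ⟧                 ≡⟨ cong (λ x → x + ⟦ r k ⟧ + ⟦ b k ⟧) (ascent real (top k)) ⟩
    H (α₁ (inject₁ k)) + ⟦ t k ⟧ + ⟦ r k ⟧ + ⟦ b k ⟧   ≡⟨ regroup (H (α₁ (inject₁ k))) ⟦ t k ⟧ ⟦ r k ⟧ ⟦ b k ⟧ ⟩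
    H (α₁ (inject₁ k)) + (⟦ t k ⟧ + ⟦ r k ⟧ + ⟦ b k ⟧) ∎)
  where
  open ≡-Reasoning
  l t r b : Fin n → Sign
  l = μ ∘ left
  t = μ ∘ top
  r = μ ∘ horizontal ∘ suc
  b = μ ∘ bottom
  regroup : ∀ h x y z → h + x + y + z ≡ h + (x + y + z)
  regroup = solve-∀

partialSum : ∀ {n} → (Fin n → ℤ) → Fin (suc n) → ℤ
partialSum f zero = 0ℤ
partialSum {suc n} f (suc j) = f zero + partialSum (f ∘ suc) j

partialSum-suc : ∀ {n} (f : Fin n → ℤ) k → partialSum f (suc k) ≡ partialSum f (inject₁ k) + f k
partialSum-suc f zero    = ℤ.+-comm (f zero) 0ℤ
partialSum-suc f (suc k) = trans (cong (λ x → f zero + x) (partialSum-suc (f ∘ suc) k))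
  (sym (ℤ.+-assoc (f zero) _ _))

-- The top creases fix the heights of the first row by partial sums, and the horizontal creases fix
-- those of the second. Only the bottom creases then demand a proof, and for them the condition is
-- balance at the vertex.
valid⇒realizable : ∀ {n} (μ : Assignment (suc n)) → LocallyValid μ → ∃ (Realizes μ)
valid⇒realizable {n} μ valid = H , real
  where
  u : Fin (suc n) → ℤ
  u = partialSum (λ k → ⟦ μ (top k) ⟧)
  H : Height (suc n)
  H (α₁ j) = u j
  H (α₂ j) = u j + ⟦ μ (horizontal j) ⟧
  regroup : ∀ h x y z → h + (x + y + z) ≡ h + x + y + z
  regroup = solve-∀
  real : Realizes μ H
  real .ascent (horizontal j) = refl
  real .ascent (top k)        = partialSum-suc _ k
  real .ascent (bottom k)     =
    trans (cong (λ x → u (inject₁ k) + x) (valid⇒balanced μ valid k))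
   (trans (regroup (u (inject₁ k)) ⟦ μ (top k) ⟧ ⟦ μ (horizontal (suc k)) ⟧ ⟦ μ (bottom k) ⟧)
          (cong (λ x → x + ⟦ μ (horizontal (suc k)) ⟧ + ⟦ μ (bottom k) ⟧) (sym (partialSum-suc _ k))))

-- Local extrema

-- For σ = + the face is a local minimum of any realizing height, for σ = - a local maximum. In both
-- cases flipping it moves its height by 2σ.
record Extremal {n} (μ : Assignment n) (α : Face n) (σ : Sign) : Set where
  field
    outgoing : ∀ e → tail e ≡ α → μ e ≡ σ
    incoming : ∀ e → head e ≡ α → μ e ≡ opposite σ
open Extremal

-- One pair of hypotheses serves both rows: passing to the second row reverses the horizontal crease
-- and the side creases alike, as seen from the face, so only the resulting σ changes.
face-extremal : ∀ {n} (μ : Assignment (suc n)) r j →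
  (∀ k → inject₁ k ≡ j → μ (side r k) ≡ μ (horizontal j)) →
  (∀ k → suc k ≡ j → μ (side r k) ≡ opposite (μ (horizontal j))) →
  ∃ (Extremal μ (face r j))
face-extremal μ row₁ j after before = μ (horizontal j) , record
  { outgoing = λ { (horizontal i) refl → refl ; (top k) eq → after k (α₁-injective eq) ; (bottom k) () }
  ; incoming = λ { (horizontal i) () ; (top k) eq → before k (α₁-injective eq) ; (bottom k) () } }
face-extremal μ row₂ j after before = opposite (μ (horizontal j)) , record
  { outgoing = λ { (horizontal i) () ; (top k) () ; (bottom k) eq → before k (α₂-injective eq) }
  ; incoming = λ { (horizontal i) refl → sym (opposite-involutive _) ; (top k) ()
                 ; (bottom k) eq → trans (after k (α₂-injective eq)) (sym (opposite-involutive _)) } }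

flipped-balanced : ∀ {n} (μ : Assignment n) α → Flippable μ α → ∀ k {l t r b} →
  flip α μ (left k) ≡ l → flip α μ (top k) ≡ t →
  flip α μ (horizontal (rightColumn k)) ≡ r → flip α μ (bottom k) ≡ b → Balanced l t r b
flipped-balanced μ α (_ , valid′) k refl refl refl refl = valid⇒balanced (flip α μ) valid′ k

-- At each vertex on its boundary a face has its horizontal crease and one side crease. Balance
-- before and after negating these two signs forces their contributions to cancel, which ties the
-- side crease to the horizontal one.
flippable⇒extremal : ∀ {n} (μ : Assignment (suc n)) α → Flippable μ α → ∃ (Extremal μ α)
flippable⇒extremal μ (α₁ j) fl@(valid , _) = face-extremal μ row₁ j after before
  where
  after : ∀ k → inject₁ k ≡ j → μ (top k) ≡ μ (horizontal j)
  after k refl = balanced-oppositeˡ (μ (left k)) _ (μ (horizontal (suc k))) (μ (bottom k)) (valid⇒balanced μ valid k)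
    (flipped-balanced μ (α₁ j) fl k
      (flip-borders (α₁ j) μ (left k) refl)
      (flip-borders (α₁ j) μ (top k) (inj₁ refl))
      (flip-fixes (α₁ j) μ (horizontal (suc k)) (suc≢inject₁ k ∘ α₁-injective) λ ())
      (flip-fixes (α₁ j) μ (bottom k) (λ ()) λ ()))
  before : ∀ k → suc k ≡ j → μ (top k) ≡ opposite (μ (horizontal j))
  before k refl = balanced-oppositeʳ (μ (left k)) _ (μ (horizontal (suc k))) (μ (bottom k)) (valid⇒balanced μ valid k)
    (flipped-balanced μ (α₁ j) fl k
      (flip-fixes (α₁ j) μ (left k) (suc≢inject₁ k ∘ sym ∘ α₁-injective) λ ())
      (flip-borders (α₁ j) μ (top k) (inj₂ refl))
      (flip-borders (α₁ j) μ (horizontal (suc k)) refl)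
      (flip-fixes (α₁ j) μ (bottom k) (λ ()) λ ()))
flippable⇒extremal μ (α₂ j) fl@(valid , _) = face-extremal μ row₂ j after before
  where
  after : ∀ k → inject₁ k ≡ j → μ (bottom k) ≡ μ (horizontal j)
  after k refl = balanced-oppositeˡ (μ (left k)) _ (μ (horizontal (suc k))) (μ (top k))
    (balanced-swap (μ (left k)) (μ (top k)) _ (μ (bottom k)) (valid⇒balanced μ valid k))
    (balanced-swap (opposite (μ (left k))) (μ (top k)) _ (opposite (μ (bottom k))) (flipped-balanced μ (α₂ j) fl k
      (flip-borders (α₂ j) μ (left k) refl)
      (flip-fixes (α₂ j) μ (top k) (λ ()) λ ())
      (flip-fixes (α₂ j) μ (horizontal (suc k)) (λ ()) (suc≢inject₁ k ∘ α₂-injective))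
      (flip-borders (α₂ j) μ (bottom k) (inj₁ refl))))
  before : ∀ k → suc k ≡ j → μ (bottom k) ≡ opposite (μ (horizontal j))
  before k refl = balanced-oppositeʳ (μ (left k)) _ (μ (horizontal (suc k))) (μ (top k))
    (balanced-swap (μ (left k)) (μ (top k)) _ (μ (bottom k)) (valid⇒balanced μ valid k))
    (balanced-swap (μ (left k)) (μ (top k)) _ (opposite (μ (bottom k))) (flipped-balanced μ (α₂ j) fl k
      (flip-fixes (α₂ j) μ (left k) (λ ()) (suc≢inject₁ k ∘ sym ∘ α₂-injective))
      (flip-fixes (α₂ j) μ (top k) (λ ()) λ ())
      (flip-borders (α₂ j) μ (horizontal (suc k)) refl)
      (flip-borders (α₂ j) μ (bottom k) (inj₂ refl))))

bump : ∀ {n} → Face n → ℤ → Face n → ℤ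
bump α z f = if does (f ≟ᶠ α) then z else 0ℤ

bump-at : ∀ {n} {α : Face n} z {f} → f ≡ α → bump α z f ≡ z
bump-at {α = α} z {f} eq rewrite dec-true (f ≟ᶠ α) eq = refl

bump-off : ∀ {n} {α : Face n} z {f} → f ≢ α → bump α z f ≡ 0ℤ
bump-off {α = α} z {f} neq rewrite dec-false (f ≟ᶠ α) neq = refl

infixl 6 _⊕_
-- Displacements are measured in units of 2, the effect of one flip, so that `K f` is the net number
-- of times `f` has to be raised and the ℓ¹-norm of `K` counts flips.
_⊕_ : ∀ {n} → Height n → (Face n → ℤ) → Height n
(H ⊕ K) f = H f + + 2 * K f

flip-realizes : ∀ {n} {μ : Assignment n} {H α σ} → Realizes μ H → Extremal μ α σ →
  Realizes (flip α μ) (H ⊕ bump α ⟦ σ ⟧)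
flip-realizes {n} {μ} {H} {α} {σ} real ext .ascent e with tail e ≟ᶠ α | head e ≟ᶠ α
... | yes t≡α | yes h≡α = contradiction (trans t≡α (sym h≡α)) (tail≢head e)
... | yes refl | no h≢α
  rewrite flip-borders (tail e) μ e (tail-borders e) | ascent real e | outgoing ext e refl | ⟦⟧-opposite σ = arith (H (tail e)) ⟦ σ ⟧
  where
  arith : ∀ x s → x + s + + 2 * 0ℤ ≡ x + + 2 * s + - s
  arith = solve-∀
... | no t≢α | yes refl
  rewrite flip-borders (head e) μ e (head-borders e) | ascent real e | incoming ext e refl | opposite-involutive σ | ⟦⟧-opposite σ = arith (H (tail e)) ⟦ σ ⟧
  where
  arith : ∀ x s → x + - s + + 2 * s ≡ x + + 2 * 0ℤ + s
  arith = solve-∀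
... | no t≢α | no h≢α rewrite flip-fixes α μ e t≢α h≢α | ascent real e = arith (H (tail e)) ⟦ μ e ⟧
  where
  arith : ∀ x s → x + s + + 2 * 0ℤ ≡ x + + 2 * 0ℤ + s
  arith = solve-∀

-- Moving a local extremum across its neighbours yields a height function again, and the gradient of
-- a height function is automatically valid. Thus no vertex needs to be inspected.
extremal⇒flippable : ∀ {n} {μ : Assignment (suc n)} {α σ} → LocallyValid μ → Extremal μ α σ → Flippable μ α
extremal⇒flippable {μ = μ} valid ext =
  valid , realizes⇒valid (flip-realizes (proj₂ (valid⇒realizable μ valid)) ext)

-- Sums over faces

-- The change of a single term is expressed additively, with the old and new value on opposite
-- sides, to avoid truncated subtraction.
sum-update : ∀ {n} {f g : Fin n → ℕ} i → (∀ j → j ≢ i → g j ≡ f j) →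
  sum g ℕ.+ f i ≡ sum f ℕ.+ g i
sum-update {suc n} {f} {g} zero same =
  trans (cong (λ x → g zero ℕ.+ x ℕ.+ f zero) (sum-cong-≗ λ j → same (suc j) λ ()))
        (rotate (g zero) (sum (f ∘ suc)) (f zero))
  where
  rotate : ∀ x y z → x ℕ.+ y ℕ.+ z ≡ z ℕ.+ y ℕ.+ x
  rotate = ℕ-Solver.solve-∀
sum-update {suc n} {f} {g} (suc i) same = begin
  g zero ℕ.+ sum (g ∘ suc) ℕ.+ f (suc i)   ≡⟨ cong (λ x → x ℕ.+ sum (g ∘ suc) ℕ.+ f (suc i)) (same zero λ ()) ⟩
  f zero ℕ.+ sum (g ∘ suc) ℕ.+ f (suc i)   ≡⟨ ℕ.+-assoc (f zero) _ _ ⟩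
  f zero ℕ.+ (sum (g ∘ suc) ℕ.+ f (suc i)) ≡⟨ cong (λ x → f zero ℕ.+ x) (sum-update i λ j j≢i → same (suc j) (j≢i ∘ Fin.suc-injective)) ⟩
  f zero ℕ.+ (sum (f ∘ suc) ℕ.+ g (suc i)) ≡⟨ ℕ.+-assoc (f zero) _ _ ⟨
  f zero ℕ.+ sum (f ∘ suc) ℕ.+ g (suc i)   ∎
  where open ≡-Reasoning

nonzero-term : ∀ {n} (f : Fin n → ℕ) → sum f ≢ 0 → ∃ λ i → f i ≢ 0
nonzero-term {zero}  f sum≢0 = contradiction refl sum≢0
nonzero-term {suc n} f sum≢0 with f zero ℕ.≟ 0
... | no f₀≢0  = zero , f₀≢0
... | yes f₀≡0 with i , fᵢ≢0 ← nonzero-term (f ∘ suc) (sum≢0 ∘ cong₂ ℕ._+_ f₀≡0) = suc i , fᵢ≢0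

term≤sum : ∀ {n} (f : Fin n → ℕ) i → f i ℕ.≤ sum f
term≤sum f zero    = ℕ.m≤m+n _ _
term≤sum f (suc i) = ℕ.≤-trans (term≤sum (f ∘ suc) i) (ℕ.m≤n+m _ _)

∑ᶠ : ∀ {n} → (Face n → ℕ) → ℕ
∑ᶠ f = sum (f ∘ α₁) ℕ.+ sum (f ∘ α₂)

∑ᶠ-cong : ∀ {n} {f g : Face n → ℕ} → f ≗ g → ∑ᶠ f ≡ ∑ᶠ g
∑ᶠ-cong eq = cong₂ ℕ._+_ (sum-cong-≗ (eq ∘ α₁)) (sum-cong-≗ (eq ∘ α₂))

∑ᶠ-update : ∀ {n} {f g : Face n → ℕ} α → (∀ β → β ≢ α → g β ≡ f β) →
  ∑ᶠ g ℕ.+ f α ≡ ∑ᶠ f ℕ.+ g α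
∑ᶠ-update {f = f} {g} (α₁ i) same = begin
  sum (g ∘ α₁) ℕ.+ sum (g ∘ α₂) ℕ.+ f (α₁ i)   ≡⟨ cong (λ x → sum (g ∘ α₁) ℕ.+ x ℕ.+ f (α₁ i)) (sum-cong-≗ λ j → same (α₂ j) λ ()) ⟩
  sum (g ∘ α₁) ℕ.+ sum (f ∘ α₂) ℕ.+ f (α₁ i)   ≡⟨ exchange (sum (g ∘ α₁)) _ _ ⟩
  sum (g ∘ α₁) ℕ.+ f (α₁ i) ℕ.+ sum (f ∘ α₂)   ≡⟨ cong (ℕ._+ sum (f ∘ α₂)) (sum-update i λ j j≢i → same (α₁ j) (j≢i ∘ α₁-injective)) ⟩
  sum (f ∘ α₁) ℕ.+ g (α₁ i) ℕ.+ sum (f ∘ α₂)   ≡⟨ exchange (sum (f ∘ α₁)) _ _ ⟩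
  sum (f ∘ α₁) ℕ.+ sum (f ∘ α₂) ℕ.+ g (α₁ i)   ∎
  where
  open ≡-Reasoning
  exchange : ∀ x y z → x ℕ.+ y ℕ.+ z ≡ x ℕ.+ z ℕ.+ y
  exchange = ℕ-Solver.solve-∀
∑ᶠ-update {f = f} {g} (α₂ i) same = begin
  sum (g ∘ α₁) ℕ.+ sum (g ∘ α₂) ℕ.+ f (α₂ i)   ≡⟨ cong (λ x → x ℕ.+ sum (g ∘ α₂) ℕ.+ f (α₂ i)) (sum-cong-≗ λ j → same (α₁ j) λ ()) ⟩
  sum (f ∘ α₁) ℕ.+ sum (g ∘ α₂) ℕ.+ f (α₂ i)   ≡⟨ ℕ.+-assoc (sum (f ∘ α₁)) _ _ ⟩
  sum (f ∘ α₁) ℕ.+ (sum (g ∘ α₂) ℕ.+ f (α₂ i)) ≡⟨ cong (λ x → sum (f ∘ α₁) ℕ.+ x) (sum-update i λ j j≢i → same (α₂ j) (j≢i ∘ α₂-injective)) ⟩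
  sum (f ∘ α₁) ℕ.+ (sum (f ∘ α₂) ℕ.+ g (α₂ i)) ≡⟨ ℕ.+-assoc (sum (f ∘ α₁)) _ _ ⟨
  sum (f ∘ α₁) ℕ.+ sum (f ∘ α₂) ℕ.+ g (α₂ i)   ∎
  where open ≡-Reasoning

∑ᶠ-nonzero-term : ∀ {n} (f : Face n → ℕ) → ∑ᶠ f ≢ 0 → ∃ λ α → f α ≢ 0
∑ᶠ-nonzero-term f ∑≢0 with sum (f ∘ α₁) ℕ.≟ 0
... | no s≢0  with i , fᵢ≢0 ← nonzero-term (f ∘ α₁) s≢0 = α₁ i , fᵢ≢0
... | yes s≡0 with i , fᵢ≢0 ← nonzero-term (f ∘ α₂) (∑≢0 ∘ cong₂ ℕ._+_ s≡0) = α₂ i , fᵢ≢0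

term≤∑ᶠ : ∀ {n} (f : Face n → ℕ) α → f α ℕ.≤ ∑ᶠ f
term≤∑ᶠ f (α₁ i) = ℕ.≤-trans (term≤sum (f ∘ α₁) i) (ℕ.m≤m+n _ _)
term≤∑ᶠ f (α₂ i) = ℕ.≤-trans (term≤sum (f ∘ α₂) i) (ℕ.m≤n+m _ _)

-- Walks and height functions

infixl 6 _⊞_
_⊞_ : ∀ {n} → (Face n → ℤ) → (Face n → ℤ) → Face n → ℤ
(K ⊞ L) f = K f + L f

⊕-⊞ : ∀ {n} (H : Height n) K L → H ⊕ K ⊕ L ≗ H ⊕ (K ⊞ L)
⊕-⊞ H K L f = arith (H f) (K f) (L f)
  where
  arith : ∀ x y z → x + + 2 * y + + 2 * z ≡ x + + 2 * (y + z)
  arith = solve-∀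

⊕-neg : ∀ {n} (H : Height n) K → -_ ∘ (H ⊕ K) ≗ (-_ ∘ H) ⊕ (-_ ∘ K)
⊕-neg H K f = arith (H f) (K f)
  where
  arith : ∀ x y → - (x + + 2 * y) ≡ - x + + 2 * - y
  arith = solve-∀

∑-bump : ∀ {n} (α : Face n) z K →
  ∑ᶠ (∣_∣ ∘ (bump α z ⊞ K)) ℕ.+ ∣ K α ∣ ≡ ∑ᶠ (∣_∣ ∘ K) ℕ.+ ∣ z + K α ∣
∑-bump α z K = trans
  (∑ᶠ-update α λ β β≢α → cong ∣_∣ (trans (cong (_+ K β) (bump-off z β≢α)) (ℤ.+-identityˡ (K β))))
  (cong (λ x → ∑ᶠ (∣_∣ ∘ K) ℕ.+ ∣ x + K α ∣) (bump-at {α = α} z refl))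

-- Heights are carried along the walk: each step changes the displacement by ±1 at one face, so its
-- ℓ¹-norm grows by at most one. This is the lower bound on the length of walks.
walk⇒displacement : ∀ {n} {u v : OFG (suc n)} {l H} → Walk u v l → Realizes (proj₁ u) H →
  ∃ λ K → Realizes (proj₁ v) (H ⊕ K) × ∑ᶠ (∣_∣ ∘ K) ℕ.≤ l
walk⇒displacement {n} {u} {v} {H = H} (done u≗v) real =
  (λ _ → 0ℤ) , Realizes-cong u≗v (λ f → sym (ℤ.+-identityʳ (H f))) real , ℕ.≤-reflexive (∑0 {suc n})
  where
  ∑0 : ∀ {m} → ∑ᶠ {m} (λ _ → 0) ≡ 0
  ∑0 {m} = cong₂ ℕ._+_ (sum-replicate-zero m) (sum-replicate-zero m)
walk⇒displacement {u = u} {H = H} (step {l = l} (α , fl , v≗flip) walk) real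
  with σ , ext ← flippable⇒extremal (proj₁ u) α fl
  with K , real′ , ∑≤l ← walk⇒displacement walk
         (Realizes-cong (sym ∘ v≗flip) (λ _ → refl) (flip-realizes real ext)) =
  bump α ⟦ σ ⟧ ⊞ K , Realizes-cong (λ _ → refl) (⊕-⊞ H (bump α ⟦ σ ⟧) K) real′ ,
  ℕ.+-cancelʳ-≤ ∣ K α ∣ _ _ (begin
    ∑ᶠ (∣_∣ ∘ (bump α ⟦ σ ⟧ ⊞ K)) ℕ.+ ∣ K α ∣ ≡⟨ ∑-bump α ⟦ σ ⟧ K ⟩
    ∑ᶠ (∣_∣ ∘ K) ℕ.+ ∣ ⟦ σ ⟧ + K α ∣         ≤⟨ ℕ.+-mono-≤ ∑≤l (ℤ.∣i+j∣≤∣i∣+∣j∣ ⟦ σ ⟧ (K α)) ⟩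
    l ℕ.+ (∣ ⟦ σ ⟧ ∣ ℕ.+ ∣ K α ∣)            ≡⟨ cong (λ x → l ℕ.+ (x ℕ.+ ∣ K α ∣)) (unit σ) ⟩
    l ℕ.+ suc ∣ K α ∣                       ≡⟨ ℕ.+-suc l _ ⟩
    suc l ℕ.+ ∣ K α ∣                       ∎)
  where
  open ℕ.≤-Reasoning
  unit : ∀ s → ∣ ⟦ s ⟧ ∣ ≡ 1
  unit Sign.+ = refl
  unit Sign.- = refl

faces : ∀ n → List (Face n)
faces n = map α₁ (allFin n) ++ map α₂ (allFin n)

∈-faces : ∀ {n} (α : Face n) → α ∈ faces n
∈-faces (α₁ j) = ∈-++⁺ˡ (∈-map⁺ α₁ (∈-allFin j))
∈-faces (α₂ j) = ∈-++⁺ʳ (map α₁ (allFin _)) (∈-map⁺ α₂ (∈-allFin j))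

-- A lowest face among those still to be raised is a local minimum: a lower
-- neighbour would have to be raised at least as often.
extremal-below : ∀ {n} {μ ν : Assignment n} {H K} → Realizes μ H → Realizes ν (H ⊕ K) →
  ∀ {β} → 0ℤ < K β → ∃ λ α → Extremal μ α Sign.+ × 0ℤ < K α
extremal-below {n} {μ} {ν} {H} {K} realH realG {β} 0<Kβ = α , ext , 0<Kα
  where
  raised : List (Face n)
  raised = filter (λ f → 0ℤ ℤ.<? K f) (faces n)

  α : Face n
  -- The default `β` is itself a raised face, so the minimum is attained at a raised face.
  α = argmin H β raised

  0<Kα : 0ℤ < K α
  0<Kα = argmin-all H {P = λ f → 0ℤ < K f} 0<Kβ (all-filter (λ f → 0ℤ ℤ.<? K f) (faces n))

  lowest : ∀ γ → 0ℤ < K γ → H α ℤ.≤ H γ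
  lowest γ 0<Kγ = All.lookup (f[argmin]≤f[xs] {f = H} β raised) (∈-filter⁺ (λ f → 0ℤ ℤ.<? K f) (∈-faces γ) 0<Kγ)

  -- Subtracting the current step -1 from the target step `s` gives 2 `K γ` = 2 `K α` + (`s` + 1),
  -- so `K γ` is `K α` or `K α` + 1.
  still-raised : ∀ γ s → (H ⊕ K) γ ≡ (H ⊕ K) α + ⟦ s ⟧ → H γ ≡ H α + -[1+ 0 ] → 0ℤ < K γ
  still-raised γ s g h = raise s (begin
    + 2 * K γ                                         ≡⟨ isolate (H γ) (+ 2 * K γ) ⟩
    (H ⊕ K) γ + - H γ                                 ≡⟨ cong₂ (λ x y → x + - y) g h ⟩
    (H ⊕ K) α + ⟦ s ⟧ + - (H α + -[1+ 0 ])            ≡⟨ collect (H α) (K α) ⟦ s ⟧ ⟩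
    + 2 * K α + (⟦ s ⟧ + + 1)                         ∎)
    where
    open ≡-Reasoning
    isolate : ∀ x y → y ≡ x + y + - x
    isolate = solve-∀
    collect : ∀ x y s → x + + 2 * y + s + - (x + -[1+ 0 ]) ≡ + 2 * y + (s + + 1)
    collect = solve-∀
    distrib : ∀ x → + 2 * x + + 2 ≡ + 2 * (x + + 1)
    distrib = solve-∀
    raise : ∀ s → + 2 * K γ ≡ + 2 * K α + (⟦ s ⟧ + + 1) → 0ℤ < K γ
    raise Sign.+ eq = subst (0ℤ <_) (sym (ℤ.*-cancelˡ-≡ (+ 2) (K γ) (K α + + 1) (trans eq (distrib (K α)))))
                        (ℤ.+-mono-< 0<Kα (+<+ (s≤s z≤n)))
    raise Sign.- eq = subst (0ℤ <_) (sym (ℤ.*-cancelˡ-≡ (+ 2) (K γ) (K α) (trans eq (ℤ.+-identityʳ (+ 2 * K α))))) 0<Kα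

  no-lower : ∀ γ s → (H ⊕ K) γ ≡ (H ⊕ K) α + ⟦ s ⟧ → H γ ≢ H α + -[1+ 0 ]
  no-lower γ s g h = ℤ.<⇒≱ lower (lowest γ (still-raised γ s g h))
    where
    lower : H γ < H α
    lower = begin-strict
      H γ            ≡⟨ h ⟩
      H α + -[1+ 0 ] <⟨ ℤ.+-monoʳ-< (H α) -<+ ⟩
      H α + 0ℤ       ≡⟨ ℤ.+-identityʳ (H α) ⟩
      H α            ∎
      where open ℤ.≤-Reasoning

  reverse : ∀ {x y} s → y ≡ x + ⟦ s ⟧ → x ≡ y + ⟦ opposite s ⟧
  reverse {x} s refl = trans (arith x ⟦ s ⟧) (cong (λ z → x + ⟦ s ⟧ + z) (sym (⟦⟧-opposite s)))
    where
    arith : ∀ x z → x ≡ x + z + - z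
    arith = solve-∀

  ext : Extremal μ α Sign.+
  ext .outgoing e t≡α with μ e in eq
  ... | Sign.+ = refl
  ... | Sign.- = contradiction (trans (ascent realH e) (cong₂ (λ f s → H f + ⟦ s ⟧) t≡α eq))
                   (no-lower (head e) (ν e) (trans (ascent realG e) (cong (λ f → (H ⊕ K) f + ⟦ ν e ⟧) t≡α)))
  ext .incoming e h≡α with μ e in eq
  ... | Sign.- = refl
  ... | Sign.+ = contradiction
                   (reverse Sign.+ (trans (cong H (sym h≡α)) (trans (ascent realH e) (cong (λ s → H (tail e) + ⟦ s ⟧) eq))))
                   (no-lower (tail e) (opposite (ν e)) (reverse (ν e) (trans (cong (H ⊕ K) (sym h≡α)) (ascent realG e))))

extremal-negate : ∀ {n} {μ : Assignment n} {α σ} → Extremal (negate μ) α σ → Extremal μ α (opposite σ)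
extremal-negate {σ = σ} ext .outgoing e t≡α =
  opposite-injective (trans (outgoing ext e t≡α) (sym (opposite-involutive σ)))
extremal-negate {σ = σ} ext .incoming e h≡α =
  opposite-injective (trans (incoming ext e h≡α) (cong opposite (sym (opposite-involutive σ))))

extremal-towards : ∀ {n} {μ ν : Assignment n} {H K} → Realizes μ H → Realizes ν (H ⊕ K) →
  ∀ {β} → ∣ K β ∣ ≢ 0 → ∃₂ λ α σ → Extremal μ α σ × ∣ K α ∣ ≡ suc ∣ - ⟦ σ ⟧ + K α ∣
extremal-towards {H = H} {K} realH realG {β} Kβ≢0 with K β in eq
... | + zero  = contradiction refl Kβ≢0
... | + suc k with α , ext , 0<Kα ← extremal-below {K = K} realH realG {β} (subst (0ℤ <_) (sym eq) (+<+ (s≤s z≤n))) =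
  α , Sign.+ , ext , closer (K α) 0<Kα
  where
  closer : ∀ x → 0ℤ < x → ∣ x ∣ ≡ suc ∣ -[1+ 0 ] + x ∣
  closer (+ suc x) _ = refl
  closer (+ zero) (+<+ ())
-- A face to be lowered becomes a face to be raised once the assignment and all heights are negated,
-- and the local minimum found there is a local maximum here.
... | -[1+ k ] with α , ext , 0<Kα ← extremal-below {K = -_ ∘ K} (Realizes-negate realH)
                      (Realizes-cong (λ _ → refl) (⊕-neg H K) (Realizes-negate realG))
                      {β} (subst (λ x → 0ℤ < - x) (sym eq) (+<+ (s≤s z≤n))) =
  α , Sign.- , extremal-negate ext , closer (K α) 0<Kα
  where
  closer : ∀ x → 0ℤ < - x → ∣ x ∣ ≡ suc ∣ + 1 + x ∣
  closer -[1+ zero ]  _ = refl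
  closer -[1+ suc x ] _ = refl
  closer (+ zero) (+<+ ())

-- A greedy walk: while some displacement is nonzero, there is a flip reducing the ℓ¹-norm by
-- exactly one. At norm zero the heights agree, and they determine the signs. So the bound from
-- `walk⇒displacement` is attained.
displacement⇒walk : ∀ {n} l {u v : OFG n} {H K} → Realizes (proj₁ u) H → Realizes (proj₁ v) (H ⊕ K) →
  ∑ᶠ (∣_∣ ∘ K) ≡ l → Walk u v l
displacement⇒walk zero {u} {v} {H} {K} realH realG ∑≡0 = done λ e → ⟦⟧-injective
  (+-cancelˡ (H (tail e)) _ _ (trans (sym (ascent realH e)) (ascent realH′ e)))
  where
  realH′ : Realizes (proj₁ v) H
  realH′ = Realizes-cong (λ _ → refl) unmoved realG
    where
    unmoved : H ⊕ K ≗ H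
    unmoved f = trans (cong (λ x → H f + + 2 * x) (ℤ.∣i∣≡0⇒i≡0 (ℕ.n≤0⇒n≡0 (subst (∣ K f ∣ ℕ.≤_) ∑≡0 (term≤∑ᶠ (∣_∣ ∘ K) f)))))
                      (ℤ.+-identityʳ (H f))
displacement⇒walk (suc l) {u} {v} {H} {K} realH realG ∑≡1+l
  with β , Kβ≢0 ← ∑ᶠ-nonzero-term (∣_∣ ∘ K) (λ ∑≡0 → case trans (sym ∑≡0) ∑≡1+l of λ ())
  with α , σ , ext , closer ← extremal-towards {K = K} realH realG {β} Kβ≢0 =
  step {v = flip α (proj₁ u) , valid′} (α , (proj₂ u , valid′) , λ _ → refl)
    (displacement⇒walk l realH′ (Realizes-cong (λ _ → refl) recombine realG) remaining)
  where
  realH′ : Realizes (flip α (proj₁ u)) (H ⊕ bump α ⟦ σ ⟧)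
  realH′ = flip-realizes realH ext
  valid′ : LocallyValid (flip α (proj₁ u))
  valid′ = realizes⇒valid realH′
  K′ : Face _ → ℤ
  K′ = bump α (- ⟦ σ ⟧) ⊞ K
  recombine : H ⊕ K ≗ H ⊕ bump α ⟦ σ ⟧ ⊕ K′
  recombine f with f ≟ᶠ α
  ... | yes _ = arith (H f) (K f) ⟦ σ ⟧
    where
    arith : ∀ x y s → x + + 2 * y ≡ x + + 2 * s + + 2 * (- s + y)
    arith = solve-∀
  ... | no _  = arith (H f) (K f)
    where
    arith : ∀ x y → x + + 2 * y ≡ x + + 2 * 0ℤ + + 2 * (0ℤ + y)
    arith = solve-∀
  remaining : ∑ᶠ (∣_∣ ∘ K′) ≡ l
  remaining = ℕ.+-cancelʳ-≡ ∣ K α ∣ _ _ (begin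
    ∑ᶠ (∣_∣ ∘ K′) ℕ.+ ∣ K α ∣                ≡⟨ ∑-bump α (- ⟦ σ ⟧) K ⟩
    ∑ᶠ (∣_∣ ∘ K) ℕ.+ ∣ - ⟦ σ ⟧ + K α ∣       ≡⟨ cong (ℕ._+ ∣ - ⟦ σ ⟧ + K α ∣) ∑≡1+l ⟩
    suc l ℕ.+ ∣ - ⟦ σ ⟧ + K α ∣             ≡⟨ ℕ.+-suc l _ ⟨
    l ℕ.+ suc ∣ - ⟦ σ ⟧ + K α ∣             ≡⟨ cong (l ℕ.+_) closer ⟨
    l ℕ.+ ∣ K α ∣                           ∎)
    where open ≡-Reasoning

-- Assignments with two flippable faces

module _ {m} (μ : Assignment (suc (suc m))) (valid : LocallyValid μ) where

  -- A face in the first column has a single side crease, so it is extremal as soon as that crease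
  -- agrees with the horizontal one. At the first vertex this happens in at least one row; the last
  -- column is treated symmetrically at the last vertex.
  first-column-flippable : ∃ λ r → Flippable μ (face r zero)
  first-column-flippable =
    [ (λ eq → row₁ , flippable row₁ eq) , (λ eq → row₂ , flippable row₂ eq) ]
      (balanced-left (μ (left zero)) _ (μ (horizontal (suc zero))) _ (valid⇒balanced μ valid zero))
    where
    flippable : ∀ r → μ (side r zero) ≡ μ (horizontal zero) → Flippable μ (face r zero)
    flippable r eq = extremal⇒flippable valid (proj₂ (face-extremal μ r zero (λ { zero _ → eq }) λ _ ()))

  last-column-flippable : ∃ λ r → Flippable μ (face r (fromℕ (suc m)))
  last-column-flippable =
    [ (λ eq → row₁ , flippable row₁ eq) , (λ eq → row₂ , flippable row₂ eq) ]
      (balanced-right (μ (left (fromℕ m))) _ (μ (horizontal (suc (fromℕ m)))) _ (valid⇒balanced μ valid (fromℕ m)))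
    where
    flippable : ∀ r → μ (side r (fromℕ m)) ≡ opposite (μ (horizontal (fromℕ (suc m)))) →
      Flippable μ (face r (fromℕ (suc m)))
    flippable r eq = extremal⇒flippable valid (proj₂ (face-extremal μ r (fromℕ (suc m))
      (λ k last → contradiction (sym last) Fin.fromℕ≢inject₁)
      (λ { k refl → eq })))

-- The faces of the row other than r are then flippable in no column but the
-- last, which determines the creases from left to right.
module _ {m} (μ : Assignment (suc (suc m))) (valid : LocallyValid μ) (r r′ : Row)
  (only-ends : ∀ γ → Flippable μ γ → γ ≡ face r zero ⊎ γ ≡ face r′ (fromℕ (suc m))) where

  private
    r̄ : Row
    r̄ = other r

    s : Sign
    s = μ (horizontal zero)

  not-flippable : ∀ k → ¬ Flippable μ (face r̄ (inject₁ k))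
  not-flippable k fl with only-ends (face r̄ (inject₁ k)) fl
  ... | inj₁ eq = other-face≢face r eq
  ... | inj₂ eq = Fin.fromℕ≢inject₁ (trans (sym (column-face r′ (fromℕ (suc m))))
                    (trans (sym (cong column eq)) (column-face r̄ (inject₁ k))))

  Regular : Fin (suc m) → Set
  Regular k = μ (left k) ≡ s × μ (side r k) ≡ s × μ (side r̄ k) ≡ opposite s × μ (horizontal (suc k)) ≡ s

  -- If the side crease at `k` in the row opposite to `r` agreed with the horizontal one, the face
  -- to its left in that row would be extremal, hence flippable. So this crease is the single
  -- exception at the vertex, and the other signs there equal `s`.
  advance : ∀ k → μ (left k) ≡ s → (∀ k′ → suc k′ ≡ inject₁ k → μ (side r̄ k′) ≡ opposite s) → Regular k
  advance k l≡s before =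
    l≡s , proj₁ same , r̄≡ , proj₂ same
    where
    r̄≡ : μ (side r̄ k) ≡ opposite s
    r̄≡ = ≢⇒≡opposite λ eq → not-flippable k (extremal⇒flippable valid (proj₂ (face-extremal μ r̄ (inject₁ k)
      (λ k′ same → trans (cong (μ ∘ side r̄) (Fin.inject₁-injective same)) (trans eq (sym l≡s)))
      (λ k′ prev → trans (before k′ prev) (cong opposite (sym l≡s))))))
    same : μ (side r k) ≡ s × μ (horizontal (suc k)) ≡ s
    same = balanced-opposite-side s _ _ (subst (λ x → Balanced s (μ (side r k)) (μ (horizontal (suc k))) x) r̄≡
      (subst (λ x → Balanced x (μ (side r k)) (μ (horizontal (suc k))) (μ (side r̄ k))) l≡s (balanced-side μ valid r k)))

  regular : ∀ k → Regular k
  regular = <-weakInduction Regular (advance zero refl λ _ ())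
    λ { k (_ , _ , r̄≡ , h≡) → advance (suc k) h≡ λ k′ eq → trans (cong (μ ∘ side r̄) (Fin.suc-injective eq)) r̄≡ }

  horizontal-constant : ∀ j → μ (horizontal j) ≡ s
  horizontal-constant zero    = refl
  horizontal-constant (suc k) = proj₂ (proj₂ (proj₂ (regular k)))

stairs : ∀ {n} → Row → Sign → Height n
stairs row₁ ε (α₁ j) = ⟦ ε ⟧ * + toℕ j
stairs row₁ ε (α₂ j) = ⟦ ε ⟧ * + suc (toℕ j)
stairs row₂ ε (α₁ j) = ⟦ ε ⟧ * + suc (toℕ j)
stairs row₂ ε (α₂ j) = ⟦ ε ⟧ * + toℕ j

stairs-up : ∀ {ε s} x → s ≡ ε → ⟦ ε ⟧ * + suc x ≡ ⟦ ε ⟧ * + x + ⟦ s ⟧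
stairs-up {ε} x refl = arith ⟦ ε ⟧ (+ x)
  where
  arith : ∀ e x → e * (+ 1 + x) ≡ e * x + e
  arith = solve-∀

stairs-down : ∀ {ε s} x → s ≡ opposite ε → ⟦ ε ⟧ * + x ≡ ⟦ ε ⟧ * + suc x + ⟦ s ⟧
stairs-down {ε} x refl = trans (arith ⟦ ε ⟧ (+ x)) (cong (λ z → ⟦ ε ⟧ * + suc x + z) (sym (⟦⟧-opposite ε)))
  where
  arith : ∀ e x → e * x ≡ e * (+ 1 + x) + - e
  arith = solve-∀

stairs-realizes : ∀ {n} {μ : Assignment (suc n)} r s →
  (∀ j → μ (horizontal j) ≡ s) → (∀ k → μ (side r k) ≡ s) → (∀ k → μ (side (other r) k) ≡ opposite s) →
  ∃₂ λ r ε → Realizes μ (stairs r ε)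
stairs-realizes row₁ s h t b = row₁ , s , realizes λ
  { (horizontal j) → stairs-up (toℕ j) (h j)
  ; (top k) → trans (stairs-up (toℕ k) (t k)) (cong (λ x → ⟦ s ⟧ * + x + _) (sym (Fin.toℕ-inject₁ k)))
  ; (bottom k) → trans (cong (λ x → ⟦ s ⟧ * + suc x) (Fin.toℕ-inject₁ k)) (stairs-down (suc (toℕ k)) (b k)) }
-- Horizontal creases point from the first row to the second. When the second row is the one
-- starting at 0, they run against the staircase, hence the slope `opposite s`.
stairs-realizes row₂ s h b t = row₂ , opposite s , realizes λ
  { (horizontal j) → stairs-down (toℕ j) (trans (h j) (sym (opposite-involutive s)))
  ; (top k) → trans (stairs-up (suc (toℕ k)) (t k)) (cong (λ x → ⟦ opposite s ⟧ * + suc x + _) (sym (Fin.toℕ-inject₁ k)))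
  ; (bottom k) → trans (cong (λ x → ⟦ opposite s ⟧ * + x) (Fin.toℕ-inject₁ k))
                       (stairs-down (toℕ k) (trans (b k) (sym (opposite-involutive s)))) }

-- By pigeonhole any two distinct flippable faces are the two given ones, so the faces found at the
-- two ends may take their place.
only-two-flippable : ∀ {n} (μ : Assignment n) → ExactlyTwoFlippable μ →
  ∀ {α β} → α ≢ β → Flippable μ α → Flippable μ β → ∀ γ → Flippable μ γ → γ ≡ α ⊎ γ ≡ β
only-two-flippable μ (_ , _ , _ , _ , _ , only) {α} {β} α≢β flα flβ γ flγ with only α flα | only β flβ | only γ flγ
... | inj₁ p | inj₁ q | _      = contradiction (trans p (sym q)) α≢β
... | inj₂ p | inj₂ q | _      = contradiction (trans p (sym q)) α≢β
... | inj₁ p | inj₂ q | inj₁ g = inj₁ (trans g (sym p))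
... | inj₁ p | inj₂ q | inj₂ g = inj₂ (trans g (sym q))
... | inj₂ p | inj₁ q | inj₁ g = inj₂ (trans g (sym q))
... | inj₂ p | inj₁ q | inj₂ g = inj₁ (trans g (sym p))

two-flippable⇒stairs : ∀ {m} (μ : Assignment (suc (suc m))) → LocallyValid μ → ExactlyTwoFlippable μ →
  ∃₂ λ r ε → Realizes μ (stairs r ε)
two-flippable⇒stairs {m} μ valid two
  with r , first ← first-column-flippable μ valid
  with r′ , last ← last-column-flippable μ valid =
  stairs-realizes r (μ (horizontal zero))
    (horizontal-constant μ valid r r′ only-ends)
    (λ k → proj₁ (proj₂ (regular μ valid r r′ only-ends k)))
    (λ k → proj₁ (proj₂ (proj₂ (regular μ valid r r′ only-ends k))))
  where
  first≢last : face r zero ≢ face r′ (fromℕ (suc m))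
  first≢last eq = contradiction
    (trans (sym (column-face r zero)) (trans (cong column eq) (column-face r′ (fromℕ (suc m))))) λ ()
  only-ends : ∀ γ → Flippable μ γ → γ ≡ face r zero ⊎ γ ≡ face r′ (fromℕ (suc m))
  only-ends = only-two-flippable μ two first≢last first last

-- The cost of reflecting a staircase

cost : ℕ → ℤ → ℕ
cost n y = sum {n} (λ j → ∣ y + - (+ toℕ j) ∣) ℕ.+ sum {n} (λ j → ∣ y + - (+ suc (toℕ j)) ∣)

-- As `ε` is a unit, |x - εz| = |εx - z|. This reduces every staircase to the ascending one, while
-- the choice of `r` merely exchanges the two sums.
stairs-cost : ∀ n r ε x →
  ∑ᶠ {n} (λ f → ∣ x + - stairs r ε f ∣) ≡ cost n (⟦ ε ⟧ * x)
stairs-cost n r ε x = rows r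
  where
  unit-* : ∀ ε x z → ∣ x + - (⟦ ε ⟧ * z) ∣ ≡ ∣ ⟦ ε ⟧ * x + - z ∣
  unit-* Sign.+ x z = cong₂ (λ u v → ∣ u + - v ∣) (sym (ℤ.*-identityˡ x)) (ℤ.*-identityˡ z)
  unit-* Sign.- x z = trans (sym (ℤ.∣-i∣≡∣i∣ (x + - (-[1+ 0 ] * z)))) (cong ∣_∣ (arith x z))
    where
    arith : ∀ x z → - (x + - (-[1+ 0 ] * z)) ≡ -[1+ 0 ] * x + - z
    arith = solve-∀
  low : sum {n} (λ j → ∣ x + - (⟦ ε ⟧ * + toℕ j) ∣) ≡ sum {n} (λ j → ∣ ⟦ ε ⟧ * x + - (+ toℕ j) ∣)
  low = sum-cong-≗ {n} λ j → unit-* ε x (+ toℕ j)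
  high : sum {n} (λ j → ∣ x + - (⟦ ε ⟧ * + suc (toℕ j)) ∣) ≡ sum {n} (λ j → ∣ ⟦ ε ⟧ * x + - (+ suc (toℕ j)) ∣)
  high = sum-cong-≗ {n} λ j → unit-* ε x (+ suc (toℕ j))
  rows : ∀ r → ∑ᶠ {n} (λ f → ∣ x + - stairs r ε f ∣) ≡ cost n (⟦ ε ⟧ * x)
  rows row₁ = cong₂ ℕ._+_ low high
  rows row₂ = trans (cong₂ ℕ._+_ high low) (ℕ.+-comm (sum {n} (λ j → ∣ ⟦ ε ⟧ * x + - (+ suc (toℕ j)) ∣)) _)

sum-1+ : ∀ {n} (f : Fin n → ℕ) → sum (suc ∘ f) ≡ n ℕ.+ sum f
sum-1+ {zero}  f = refl
sum-1+ {suc n} f = cong suc (trans (cong (λ x → f zero ℕ.+ x) (sum-1+ (f ∘ suc))) (exchange (f zero) n (sum (f ∘ suc))))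
  where
  exchange : ∀ x y z → x ℕ.+ (y ℕ.+ z) ≡ y ℕ.+ (x ℕ.+ z)
  exchange = ℕ-Solver.solve-∀

sum-mono-≤ : ∀ {n} {f g : Fin n → ℕ} → (∀ i → f i ≤ g i) → sum f ≤ sum g
sum-mono-≤ {zero}  f≤g = z≤n
sum-mono-≤ {suc n} f≤g = ℕ.+-mono-≤ (f≤g zero) (sum-mono-≤ (f≤g ∘ suc))

-- Column by column this is the sum of the first n odd numbers.
sum-odd : ∀ n → sum {n} toℕ ℕ.+ sum {n} (suc ∘ toℕ) ≡ n ℕ.* n
sum-odd zero    = refl
sum-odd (suc n) = begin
  b ℕ.+ sum {suc n} (suc ∘ toℕ)          ≡⟨ cong (λ x → b ℕ.+ suc x) (sum-1+ {n} (suc ∘ toℕ)) ⟩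
  b ℕ.+ suc (n ℕ.+ b)                   ≡⟨ cong (λ x → x ℕ.+ suc (n ℕ.+ b)) (sum-1+ {n} toℕ) ⟩
  n ℕ.+ a ℕ.+ suc (n ℕ.+ b)             ≡⟨ collect n a b ⟩
  a ℕ.+ b ℕ.+ suc (n ℕ.+ n)             ≡⟨ cong (ℕ._+ suc (n ℕ.+ n)) (sum-odd n) ⟩
  n ℕ.* n ℕ.+ suc (n ℕ.+ n)             ≡⟨ square n ⟩
  suc n ℕ.* suc n                       ∎
  where
  open ≡-Reasoning
  a b : ℕ
  a = sum {n} toℕ
  b = sum {n} (suc ∘ toℕ)
  collect : ∀ n a b → n ℕ.+ a ℕ.+ suc (n ℕ.+ b) ≡ a ℕ.+ b ℕ.+ suc (n ℕ.+ n)
  collect = ℕ-Solver.solve-∀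
  square : ∀ n → n ℕ.* n ℕ.+ suc (n ℕ.+ n) ≡ suc n ℕ.* suc n
  square = ℕ-Solver.solve-∀

cost-zero : ∀ n → cost n 0ℤ ≡ n ℕ.* n
cost-zero n = trans (cong₂ ℕ._+_ (sum-cong-≗ {n} λ j → neg (toℕ j)) (sum-cong-≗ {n} λ j → neg (suc (toℕ j)))) (sum-odd n)
  where
  neg : ∀ m → ∣ 0ℤ + - (+ m) ∣ ≡ m
  neg m = trans (cong ∣_∣ (ℤ.+-identityˡ (- (+ m)))) (ℤ.∣-i∣≡∣i∣ (+ m))

-- The first column has heights 0 and 1, at distances p + 1 and p from the level. The remaining
-- columns form a staircase with heights and level both shifted by one.
cost-suc : ∀ n p → cost (suc n) (+ suc p) ≡ suc (p ℕ.+ p) ℕ.+ cost n (+ p)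
cost-suc n p = trans
  (cong₂ ℕ._+_
    (cong₂ ℕ._+_ (cong ∣_∣ (ℤ.+-identityʳ (+ suc p))) (sum-cong-≗ {n} λ j → cong ∣_∣ (shift (toℕ j))))
    (cong₂ ℕ._+_ (cong ∣_∣ (trans (shift 0) (ℤ.+-identityʳ (+ p)))) (sum-cong-≗ {n} λ j → cong ∣_∣ (shift (suc (toℕ j))))))
  (collect p (sum {n} (λ j → ∣ + p + - (+ toℕ j) ∣)) (sum {n} (λ j → ∣ + p + - (+ suc (toℕ j)) ∣)))
  where
  arith : ∀ p j → (+ 1 + p) + - (+ 1 + j) ≡ p + - j
  arith = solve-∀
  shift : ∀ j → + suc p + - (+ suc j) ≡ + p + - (+ j)
  shift j = arith (+ p) (+ j)
  collect : ∀ p a b → suc p ℕ.+ a ℕ.+ (p ℕ.+ b) ≡ suc (p ℕ.+ p) ℕ.+ (a ℕ.+ b)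
  collect = ℕ-Solver.solve-∀

-- Stripping off the p columns under the level contributes the odd numbers 2p - 1, ..., 1, of sum
-- p². What remains is a staircase of r columns seen from its foot.
cost-inside : ∀ p r → cost (p ℕ.+ r) (+ p) ≡ p ℕ.* p ℕ.+ r ℕ.* r
cost-inside zero    r = cost-zero r
cost-inside (suc p) r = trans (cost-suc (p ℕ.+ r) p)
  (trans (cong (λ x → suc (p ℕ.+ p) ℕ.+ x) (cost-inside p r)) (square p r))
  where
  square : ∀ p r → suc (p ℕ.+ p) ℕ.+ (p ℕ.* p ℕ.+ r ℕ.* r) ≡ suc p ℕ.* suc p ℕ.+ r ℕ.* r
  square = ℕ-Solver.solve-∀

cost-above : ∀ n p → n ≤ p → n ℕ.* n ≤ cost n (+ p)
cost-above zero    p       _         = z≤n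
cost-above (suc n) (suc p) (s≤s n≤p) = begin
  suc n ℕ.* suc n                   ≡⟨ square n ⟩
  suc (n ℕ.+ n) ℕ.+ n ℕ.* n         ≤⟨ ℕ.+-mono-≤ (s≤s (ℕ.+-mono-≤ n≤p n≤p)) (cost-above n p n≤p) ⟩
  suc (p ℕ.+ p) ℕ.+ cost n (+ p)    ≡⟨ cost-suc n p ⟨
  cost (suc n) (+ suc p)            ∎
  where
  open ℕ.≤-Reasoning
  square : ∀ n → suc n ℕ.* suc n ≡ suc (n ℕ.+ n) ℕ.+ n ℕ.* n
  square = ℕ-Solver.solve-∀

cost-below : ∀ n p → n ℕ.* n ≤ cost n -[1+ p ]
cost-below n p = ℕ.≤-trans (ℕ.≤-reflexive (sym (sum-odd n)))
  (ℕ.+-mono-≤ (sum-mono-≤ {n} λ j → farther (toℕ j)) (sum-mono-≤ {n} λ j → farther (suc (toℕ j))))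
  where
  farther : ∀ m → m ≤ ∣ -[1+ p ] + - (+ m) ∣
  farther zero    = z≤n
  farther (suc m) = s≤s (ℕ.m≤n⇒m≤1+n (ℕ.m≤n+m m p))

-- Minimising the cost over all levels

⌈/2⌉≤ : ∀ {m} c → m ≤ c ℕ.+ c → ⌈ m /2⌉ ≤ c
⌈/2⌉≤ c m≤2c = ℕ.≤-trans (ℕ.⌈n/2⌉-mono m≤2c) (ℕ.≤-reflexive (sym (ℕ.n≡⌈n+n/2⌉ c)))

-- The two sides differ by (p - r)². To stay within ℕ, the larger number is written as the smaller
-- plus `d`, and the difference becomes d².
square-+-≤ : ∀ p r → (p ℕ.+ r) ^ 2 ≤ (p ℕ.* p ℕ.+ r ℕ.* r) ℕ.+ (p ℕ.* p ℕ.+ r ℕ.* r)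
square-+-≤ p r = [ ordered p r , (λ r≤p → subst₂ _≤_ (cong (_^ 2) (ℕ.+-comm r p))
    (cong (λ x → x ℕ.+ x) (ℕ.+-comm (r ℕ.* r) (p ℕ.* p))) (ordered r p r≤p)) ]′ (ℕ.≤-total p r)
  where
  identity : ∀ p d → ((p ℕ.+ (p ℕ.+ d)) ℕ.* ((p ℕ.+ (p ℕ.+ d)) ℕ.* 1)) ℕ.+ d ℕ.* d ≡
    (p ℕ.* p ℕ.+ (p ℕ.+ d) ℕ.* (p ℕ.+ d)) ℕ.+ (p ℕ.* p ℕ.+ (p ℕ.+ d) ℕ.* (p ℕ.+ d))
  identity = ℕ-Solver.solve-∀
  ordered : ∀ p r → p ≤ r → (p ℕ.+ r) ^ 2 ≤ (p ℕ.* p ℕ.+ r ℕ.* r) ℕ.+ (p ℕ.* p ℕ.+ r ℕ.* r)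
  ordered p r p≤r with d , refl ← ℕ.m≤n⇒∃[o]m+o≡n p≤r = ℕ.m+n≤o⇒m≤o _ (ℕ.≤-reflexive (identity p d))

⌈n²/2⌉≤n*n : ∀ n → ⌈ n ^ 2 /2⌉ ≤ n ℕ.* n
⌈n²/2⌉≤n*n n = ⌈/2⌉≤ (n ℕ.* n) (ℕ.≤-trans (ℕ.≤-reflexive (cong (n ℕ.*_) (ℕ.*-identityʳ n))) (ℕ.m≤m+n _ _))

⌈n²/2⌉≤cost : ∀ n y → ⌈ n ^ 2 /2⌉ ≤ cost n y
⌈n²/2⌉≤cost n -[1+ p ] = ℕ.≤-trans (⌈n²/2⌉≤n*n n) (cost-below n p)
-- Outside the staircase the cost is already at least n². Inside it is p² + r² with p + r = n, at
-- least half of n².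
⌈n²/2⌉≤cost n (+ p) with ℕ.≤-total n p
... | inj₁ n≤p = ℕ.≤-trans (⌈n²/2⌉≤n*n n) (cost-above n p n≤p)
... | inj₂ p≤n with r , refl ← ℕ.m≤n⇒∃[o]m+o≡n p≤n =
  ℕ.≤-trans (⌈/2⌉≤ _ (square-+-≤ p r)) (ℕ.≤-reflexive (sym (cost-inside p r)))

halves : ∀ n → ∃ λ p → n ≡ p ℕ.+ p ⊎ n ≡ p ℕ.+ suc p
halves zero = 0 , inj₁ refl
halves (suc n) with halves n
... | p , inj₁ refl = p , inj₂ (sym (ℕ.+-suc p p))
... | p , inj₂ refl = suc p , inj₁ refl

cost-median : ∀ n → ∃ λ y → cost n y ≡ ⌈ n ^ 2 /2⌉
cost-median n with halves n
... | p , inj₁ refl = + p , (begin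
  cost (p ℕ.+ p) (+ p)                                      ≡⟨ cost-inside p p ⟩
  p ℕ.* p ℕ.+ p ℕ.* p                                       ≡⟨ ℕ.n≡⌈n+n/2⌉ (p ℕ.* p ℕ.+ p ℕ.* p) ⟩
  ⌈ p ℕ.* p ℕ.+ p ℕ.* p ℕ.+ (p ℕ.* p ℕ.+ p ℕ.* p) /2⌉       ≡⟨ cong ⌈_/2⌉ (square p) ⟩
  ⌈ (p ℕ.+ p) ^ 2 /2⌉                                       ∎)
  where
  open ≡-Reasoning
  square : ∀ p → p ℕ.* p ℕ.+ p ℕ.* p ℕ.+ (p ℕ.* p ℕ.+ p ℕ.* p) ≡ (p ℕ.+ p) ℕ.* ((p ℕ.+ p) ℕ.* 1)
  square = ℕ-Solver.solve-∀
... | p , inj₂ refl = + p , (begin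
  cost (p ℕ.+ suc p) (+ p)                                  ≡⟨ cost-inside p (suc p) ⟩
  c                                                         ≡⟨ ℕ.n≡⌊n+n/2⌋ c ⟩
  ⌊ c ℕ.+ c /2⌋                                             ≡⟨ cong ⌊_/2⌋ (square p) ⟩
  ⌈ (p ℕ.+ suc p) ^ 2 /2⌉                                   ∎)
  where
  open ≡-Reasoning
  c : ℕ
  c = p ℕ.* p ℕ.+ suc p ℕ.* suc p
  -- For odd n the doubled cost is n² + 1. The extra `suc` is absorbed because the ceiling of half
  -- of a number is by definition the floor of half of its successor.
  square : ∀ p → p ℕ.* p ℕ.+ suc p ℕ.* suc p ℕ.+ (p ℕ.* p ℕ.+ suc p ℕ.* suc p) ≡
    suc ((p ℕ.+ suc p) ℕ.* ((p ℕ.+ suc p) ℕ.* 1))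
  square = ℕ-Solver.solve-∀

-- Reflecting a height function

-- The new height H + 2(x - H) = 2x - H is the mirror image of `H` at level x, so every step changes
-- sign.
reflect-realizes : ∀ {n} {μ : Assignment n} {H} x → Realizes μ H →
  Realizes (negate μ) (H ⊕ λ f → x + - H f)
reflect-realizes {μ = μ} {H} x real .ascent e = begin
  H (head e) + + 2 * (x + - H (head e))                         ≡⟨ cong (λ h → h + + 2 * (x + - h)) (ascent real e) ⟩
  H (tail e) + ⟦ μ e ⟧ + + 2 * (x + - (H (tail e) + ⟦ μ e ⟧))   ≡⟨ arith (H (tail e)) x ⟦ μ e ⟧ ⟩
  H (tail e) + + 2 * (x + - H (tail e)) + - ⟦ μ e ⟧             ≡⟨ cong (λ z → H (tail e) + + 2 * (x + - H (tail e)) + z) (⟦⟧-opposite (μ e)) ⟨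
  H (tail e) + + 2 * (x + - H (tail e)) + ⟦ opposite (μ e) ⟧    ∎
  where
  open ≡-Reasoning
  arith : ∀ h x s → h + s + + 2 * (x + - (h + s)) ≡ h + + 2 * (x + - h) + - s
  arith = solve-∀

constant-on-faces : ∀ {n} (X : Face (suc n) → ℤ) → (∀ e → X (head e) ≡ X (tail e)) →
  ∀ α → X α ≡ X (α₁ zero)
constant-on-faces X same (α₁ j) = <-weakInduction (λ j → X (α₁ j) ≡ X (α₁ zero)) refl
  (λ k eq → trans (same (top k)) eq) j
constant-on-faces X same (α₂ j) = trans (same (horizontal j)) (constant-on-faces X same (α₁ j))

-- The heights `H` and `H ⊕ K` have opposite gradients, so their sum 2(`K` + `H`) is constant along
-- every crease, hence on all faces. The constant value of `K` + `H` is the level.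
reflection-unique : ∀ {n} {μ : Assignment (suc n)} {H K} → Realizes μ H → Realizes (negate μ) (H ⊕ K) →
  ∃ λ x → K ≗ λ f → x + - H f
reflection-unique {μ = μ} {H} {K} real real′ = K (α₁ zero) + H (α₁ zero) , λ f →
  trans (isolate (K f) (H f)) (cong (_+ - H f) (constant-on-faces (K ⊞ H) same f))
  where
  open ≡-Reasoning
  isolate : ∀ x y → x ≡ x + y + - y
  isolate = solve-∀
  double : ∀ x y → + 2 * (x + y) ≡ (y + + 2 * x) + y
  double = solve-∀
  cancel : ∀ g h s → g + - s + (h + s) ≡ g + h
  cancel = solve-∀
  same : ∀ e → (K ⊞ H) (head e) ≡ (K ⊞ H) (tail e)
  same e = ℤ.*-cancelˡ-≡ (+ 2) ((K ⊞ H) (head e)) ((K ⊞ H) (tail e)) (begin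
    + 2 * (K ⊞ H) (head e)                                        ≡⟨ double (K (head e)) (H (head e)) ⟩
    (H ⊕ K) (head e) + H (head e)                                 ≡⟨ cong₂ _+_ (ascent real′ e) (ascent real e) ⟩
    (H ⊕ K) (tail e) + ⟦ opposite (μ e) ⟧ + (H (tail e) + ⟦ μ e ⟧) ≡⟨ cong (λ z → (H ⊕ K) (tail e) + z + (H (tail e) + ⟦ μ e ⟧)) (⟦⟧-opposite (μ e)) ⟩
    (H ⊕ K) (tail e) + - ⟦ μ e ⟧ + (H (tail e) + ⟦ μ e ⟧)         ≡⟨ cancel ((H ⊕ K) (tail e)) (H (tail e)) ⟦ μ e ⟧ ⟩
    (H ⊕ K) (tail e) + H (tail e)                                 ≡⟨ double (K (tail e)) (H (tail e)) ⟨
    + 2 * (K ⊞ H) (tail e)                                        ∎)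

stairs-distance : ∀ {n} {μ : Assignment (suc n)} (valid : LocallyValid μ) r ε → Realizes μ (stairs r ε) →
  IsDistance (μ , valid) (opp (μ , valid)) ⌈ suc n ^ 2 /2⌉
stairs-distance {n} {μ} valid r ε real = shortest , minimal
  where
  shortest : Walk (μ , valid) (opp (μ , valid)) ⌈ suc n ^ 2 /2⌉
  shortest with y , cost≡ ← cost-median (suc n) =
    -- The median `y` belongs to the ascending staircase; multiplying it by the unit `ε` gives the
    -- level for the actual one.
    displacement⇒walk ⌈ suc n ^ 2 /2⌉ real (reflect-realizes (⟦ ε ⟧ * y) real)
      (trans (stairs-cost (suc n) r ε (⟦ ε ⟧ * y)) (trans (cong (cost (suc n)) (unit² ε y)) cost≡))
    where
    unit² : ∀ ε y → ⟦ ε ⟧ * (⟦ ε ⟧ * y) ≡ y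
    unit² Sign.+ y = trans (ℤ.*-identityˡ (+ 1 * y)) (ℤ.*-identityˡ y)
    unit² Sign.- = arith
      where
      arith : ∀ y → -[1+ 0 ] * (-[1+ 0 ] * y) ≡ y
      arith = solve-∀
  minimal : ∀ l → Walk (μ , valid) (opp (μ , valid)) l → ⌈ suc n ^ 2 /2⌉ ≤ l
  minimal l walk
    with K , real′ , ∑≤l ← walk⇒displacement walk real
    -- Whatever the walk, its total displacement is a reflection at some level, so the minimum of
    -- the cost over all levels bounds its length.
    with x , K≗ ← reflection-unique {K = K} real real′ = begin
    ⌈ suc n ^ 2 /2⌉                        ≤⟨ ⌈n²/2⌉≤cost (suc n) (⟦ ε ⟧ * x) ⟩
    cost (suc n) (⟦ ε ⟧ * x)               ≡⟨ stairs-cost (suc n) r ε x ⟨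
    ∑ᶠ {suc n} (λ f → ∣ x + - stairs r ε f ∣) ≡⟨ ∑ᶠ-cong {suc n} (cong ∣_∣ ∘ K≗) ⟨
    ∑ᶠ (∣_∣ ∘ K)                           ≤⟨ ∑≤l ⟩
    l                                      ∎
    where open ℕ.≤-Reasoning

theorem5p5 : (n : ℕ) → 2 ≤ n →
    (μ : Assignment n) (valid : LocallyValid μ) →
    ExactlyTwoFlippable μ →
    IsDistance (μ , valid) (opp (μ , valid)) ⌈ n ^ 2 /2⌉
theorem5p5 (suc zero) (s≤s ()) μ valid two
theorem5p5 (suc (suc m)) 2≤n μ valid two =
  let r , ε , real = two-flippable⇒stairs μ valid two
  in  stairs-distance valid r ε real
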